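{- Let $\mathcal{A}=\langle S,s^0,L,\Delta\rangle$ be a probabilistic automaton and let $c\subseteq\{(s,a,\mu)\in\Delta\mid a=\tau,\ \mu\text{ is deterministic}\}$ be a probabilistically confluent set of $\tau$-transitions. Let $\phi_c:S\to S$ be a representation map for $\mathcal{A}$ under $c$. Then the automaton $\mathcal{A}/\phi_c$ and $\mathcal{A}$ are branching probabilistically bisimilar.
   Context: Distributions. $\mathrm{Distr}(S)$ is the set of probability distributions $\mu:S\to[0,1]$, $\sum_{s\in S}\mu(s)=1$, on a countable set $S$. $\mathbb{1}_t$ is the deterministic distribution with $\mathbb{1}_t(t)=1$. For an equivalence relation $R$ on $S$, $\mu\equiv_R\mu'$ means $\mu(C)=\mu'(C)$ for all $C\in S/R$, where $\mu(C)=\sum_{s\in C}\mu(s)$. Probabilistic automata. A probabilistic automaton (PA) is a tuple $\langle S,s^0,L,\Delta\rangle$ with $S$ a countable set of states, $s^0\in S$ initial, $L$ a countable set of actions containing the unobservable action $\tau$, and $\Delta\subseteq S\times L\times\mathrm{Distr}(S)$ a countable transition relation. Write $s\xrightarrow{a}\mu$ for $(s,a,\mu)\in\Delta$, and $s\xrightarrow{a}t$ for $s\xrightarrow{a}\mathbb{1}_t$. Paths and schedulers. A finite path is a sequence $\pi=s_0\,(a_1,\mu_1)\,s_1\,(a_2,\mu_2)\cdots(a_n,\mu_n)\,s_n$ ($n\ge 0$) with $s_{i}\xrightarrow{a_{i+1}}\mu_{i+1}$ and $\mu_{i+1}(s_{i+1})>0$; $\mathrm{last}(\pi)=s_n$.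 A scheduler $\mathcal{S}$ assigns to every finite path $\pi$ a probability distribution over $\{\bot\}\cup\Delta$, giving positive probability only to $\bot$ and to transitions $(s,a,\mu)$ with $s=\mathrm{last}(\pi)$ ($\bot$ means stopping). The probability of $\pi$ from $s$ is defined by $P_s^{\mathcal{S}}(s)=1$, $P_s^{\mathcal{S}}(\pi\,(a,\mu)\,t)=P_s^{\mathcal{S}}(\pi)\cdot\mathcal{S}(\pi)(\mathrm{last}(\pi),a,\mu)\cdot\mu(t)$. A maximal path of $\mathcal{S}$ from $s$ is a finite path from $s$ all of whose transitions are scheduled with positive probability after the corresponding prefix and with $\mathcal{S}(\pi)(\bot)>0$. The final state (sub)distribution is $F^{\mathcal{S}}(s)(s')=\sum_{\pi}P_s^{\mathcal{S}}(\pi)\cdot\mathcal{S}(\pi)(\bot)$, over maximal paths $\pi$ of $\mathcal{S}$ from $s$ with $\mathrm{last}(\pi)=s'$. Branching steps. For an equivalence relation $R$ on $S$, $s\Rightarrow^a_R\mu$ if either (1) $a=\tau$ and $\mu=\mathbb{1}_s$, or (2) there is a scheduler $\mathcal{S}$ with $F^{\mathcal{S}}(s)=\mu$ such that every maximal path $s\,(a_1,\mu_1)\,s_1\cdots(a_n,\mu_n)\,s_n$ of $\mathcal{S}$ from $s$ satisfies $a_n=a$ (in particular $n\ge1$) and $a_i=\tau$, $(s,s_i)\in R$ for all $1\le i<n$. Bisimulation. An equivalence relation $R\subseteq S\times S$ is a branching probabilistic bisimulation if for all $(s,t)\in R$: $s\xrightarrow{a}\mu$ implies $\exists\mu'\in\mathrm{Distr}(S)$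 with $t\Rightarrow^a_R\mu'$ and $\mu\equiv_R\mu'$. States $p,q$ are branching probabilistically bisimilar if $(p,q)\in R$ for some branching probabilistic bisimulation $R$. Two PAs are branching probabilistically bisimilar if their initial states are so in the disjoint union of the two PAs. Confluence. Let $c$ be a set of $\tau$-transitions with deterministic distributions. Write $s\to_c t$ if $(s,\tau,\mathbb{1}_t)\in c$; $s\twoheadrightarrow_c t$ if there is a finite (possibly empty) path of $\to_c$-steps from $s$ to $t$. Let $R_c=\{(s,s')\mid\exists u:\ s\twoheadrightarrow_c u\text{ and }s'\twoheadrightarrow_c u\}$. The set $c$ is probabilistically confluent if $R_c$ is an equivalence relation and, for every path $s\twoheadrightarrow_c t$ and all $a\in L$, $\mu\in\mathrm{Distr}(S)$: $s\xrightarrow{a}\mu$ implies [($\exists\nu\in\mathrm{Distr}(S)$: $t\xrightarrow{a}\nu$ and $\mu\equiv_{R_c}\nu$) or ($a=\tau$ and $\mu\equiv_{R_c}\mathbb{1}_{t}$)]. Representation maps. A function $\phi_c:S\to S$ is a representation map for $\mathcal{A}$ under $c$ if (i) for all $s,s'\in S$, $s\to_c s'$ implies $\phi_c(s)=\phi_c(s')$; and (ii) $s\twoheadrightarrow_c\phi_c(s)$ for all $s\in S$. Reduced automaton. $\mathcal{A}/\phi_c=\langle\phi_c(S),\phi_c(s^0),L,\Delta_{\phi_c}\rangle$, where $\phi_c(S)=\{\phi_c(s)\mid s\in S\}$ and $\Delta_{\phi_c}\subseteq\phi_c(S)\times L\times\mathrm{Distr}(\phi_c(S))$ contains $(s,a,\mu)$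 if and only if there is a transition $t\xrightarrow{a}\mu'$ in $\mathcal{A}$ that is not in $c$ such that $\phi_c(t)=s$ and $\mu(s')=\mu'(\{s''\in S\mid\phi_c(s'')=s'\})$ for all $s'\in\phi_c(S)$. -}

module Defs where

open import Data.Empty using (⊥)
open import Data.Irrelevant using ([_])
open import Data.List.Base using (List; []; _∷_; foldr; map)
open import Data.List.Relation.Binary.Pointwise as Pointwise using ()
open import Data.List.Relation.Unary.All using (All; []; _∷_)
open import Data.List.Relation.Unary.AllPairs using ([]; _∷_)
import Data.List.Relation.Unary.Unique.Setoid as UniqueSetoid
open import Data.Maybe.Base using (Maybe; just; nothing)
import Data.Maybe.Relation.Binary.Pointwise as MaybePointwise
open import Data.Nat.Base as ℕ using (ℕ)
import Data.Nat.Properties as ℕ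
open import Data.Product.Base using (Σ; ∃; ∃₂; _×_; _,_; proj₁; proj₂)
open import Data.Product.Relation.Binary.Pointwise.NonDependent using (×-setoid)
open import Data.Rational.Base as ℚ using (ℚ; 0ℚ; 1ℚ; ½; _<_; _≤_)
import Data.Rational.Properties as ℚ
open import Data.Refinement.Base using (Refinement-syntax; value; _,_)
open import Data.Sum.Base as Sum using (_⊎_; inj₁; inj₂)
open import Data.Sum.Properties using (inj₁-injective; inj₂-injective)
open import Data.Unit.Base using (⊤; tt)
open import Function.Base using (_∘_)
open import Function.Definitions using (Injective)
open import Level using (Level; Lift; 0ℓ; _⊔_) renaming (suc to lsuc)
open import Relation.Binary.Bundles using (Setoid)
open import Relation.Binary.Core using (Rel)
open import Relation.Binary.Definitions using (_Respects_)
open import Relation.Binary.Structures using (IsEquivalence)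
open import Relation.Binary.Construct.Closure.ReflexiveTransitive using (Star)
import Relation.Binary.Construct.On as On
open import Relation.Binary.PropositionalEquality.Core
  using (_≡_; _≢_; refl; sym; trans; cong; subst)
import Relation.Binary.PropositionalEquality.Properties as ≡
open import Relation.Nullary.Negation using (contradiction)
open import Relation.Unary using (Pred; _∈_; _∉_; _⊆_)

private
  variable
    a e p ℓ ℓ₁ ℓ₂ ℓ₃ : Level

1ℓ : Level
1ℓ = lsuc 0ℓ

-- The extended non-negative reals [0,∞], as lower Dedekind cuts:
-- `below x q` means q < x.  Classically every such cut is a number of
-- [0,∞], ∞ being the cut of all rationals.

record [0,∞] ℓ : Set (lsuc ℓ) where
  field
    below     : ℚ → Set ℓ
    negative  : ∀ {q} → q < 0ℚ → below q
    downwards : ∀ {q r} → q ≤ r → below r → below q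
    rounded   : ∀ {q} → below q → ∃ λ r → q < r × below r

open [0,∞] public

infix 4 _≃_

record _≃_ (x : [0,∞] ℓ₁) (y : [0,∞] ℓ₂) : Set (ℓ₁ ⊔ ℓ₂) where
  constructor mk≃
  field
    to   : ∀ {q} → below x q → below y q
    from : ∀ {q} → below y q → below x q

open _≃_ public

≃-refl : {x : [0,∞] ℓ} → x ≃ x
≃-refl = mk≃ (λ b → b) (λ b → b)

≃-sym : {x : [0,∞] ℓ₁} {y : [0,∞] ℓ₂} → x ≃ y → y ≃ x
≃-sym (mk≃ f g) = mk≃ g f

≃-trans : {x : [0,∞] ℓ₁} {y : [0,∞] ℓ₂} {z : [0,∞] ℓ₃} → x ≃ y → y ≃ z → x ≃ z
≃-trans (mk≃ f g) (mk≃ f′ g′) = mk≃ (f′ ∘ f) (g ∘ g′)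

Positive : [0,∞] ℓ → Set ℓ
Positive x = below x 0ℚ

-- The number 1 if P holds, and 0 otherwise.
𝟏[_] : Set → [0,∞] 0ℓ
𝟏[ P ] .below q = q < 0ℚ ⊎ (q < 1ℚ × P)
𝟏[ P ] .negative = inj₁
𝟏[ P ] .downwards q≤r (inj₁ r<0)       = inj₁ (ℚ.≤-<-trans q≤r r<0)
𝟏[ P ] .downwards q≤r (inj₂ (r<1 , h)) = inj₂ (ℚ.≤-<-trans q≤r r<1 , h)
𝟏[ P ] .rounded (inj₁ q<0) =
  let r , q<r , r<0 = ℚ.<-dense q<0 in r , q<r , inj₁ r<0
𝟏[ P ] .rounded (inj₂ (q<1 , h)) =
  let r , q<r , r<1 = ℚ.<-dense q<1 in r , q<r , inj₂ (r<1 , h)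

0# : [0,∞] 0ℓ
0# = 𝟏[ ⊥ ]

1# : [0,∞] 0ℓ
1# = 𝟏[ ⊤ ]

infixl 6 _+_
infixl 7 _*_

_+_ : [0,∞] 0ℓ → [0,∞] 0ℓ → [0,∞] 0ℓ
(x + y) .below q = ∃₂ λ r s → below x r × below y s × q ≤ r ℚ.+ s
(x + y) .negative {q} q<0 =
    ½ ℚ.* q , ½ ℚ.* q , x .negative half<0 , y .negative half<0
  , ℚ.≤-reflexive (trans (sym (ℚ.*-identityˡ q)) (ℚ.*-distribʳ-+ q ½ ½))
  where
  half<0 : ½ ℚ.* q < 0ℚ
  half<0 = subst (½ ℚ.* q <_) (ℚ.*-zeroʳ ½) (ℚ.*-monoʳ-<-pos ½ q<0)
(x + y) .downwards q≤q′ (r , s , r<x , s<y , q′≤) = r , s , r<x , s<y , ℚ.≤-trans q≤q′ q′≤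
(x + y) .rounded (r , s , r<x , s<y , q≤) =
  let r′ , r<r′ , r′<x = x .rounded r<x in
    r′ ℚ.+ s
  , ℚ.≤-<-trans q≤ (ℚ.+-mono-<-≤ r<r′ (ℚ.≤-refl {s}))
  , r′ , s , r′<x , s<y , ℚ.≤-refl

_*_ : [0,∞] 0ℓ → [0,∞] 0ℓ → [0,∞] 0ℓ
(x * y) .below q =
  q < 0ℚ ⊎ ∃₂ λ r s → (0ℚ ≤ r × below x r) × (0ℚ ≤ s × below y s) × q ≤ r ℚ.* s
(x * y) .negative = inj₁
(x * y) .downwards q≤q′ (inj₁ q′<0) = inj₁ (ℚ.≤-<-trans q≤q′ q′<0)
(x * y) .downwards q≤q′ (inj₂ (r , s , hr , hs , q′≤)) =
  inj₂ (r , s , hr , hs , ℚ.≤-trans q≤q′ q′≤)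
(x * y) .rounded (inj₁ q<0) = let r , q<r , r<0 = ℚ.<-dense q<0 in r , q<r , inj₁ r<0
(x * y) .rounded (inj₂ (r , s , (0≤r , r<x) , (0≤s , s<y) , q≤)) =
  let r′ , r<r′ , r′<x = x .rounded r<x
      s′ , s<s′ , s′<y = y .rounded s<y
      0<r′ = ℚ.≤-<-trans 0≤r r<r′
      0<s′ = ℚ.≤-<-trans 0≤s s<s′
      rs≤r′s  = ℚ.*-monoʳ-≤-nonNeg s {{ℚ.nonNegative 0≤s}} (ℚ.<⇒≤ r<r′)
      r′s<r′s′ = ℚ.*-monoʳ-<-pos r′ {{ℚ.positive 0<r′}} s<s′
  in  r′ ℚ.* s′
    , ℚ.≤-<-trans q≤ (ℚ.≤-<-trans rs≤r′s r′s<r′s′)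
    , inj₂ (r′ , s′ , (ℚ.<⇒≤ 0<r′ , r′<x) , (ℚ.<⇒≤ 0<s′ , s′<y) , ℚ.≤-refl)

sum : List ([0,∞] 0ℓ) → [0,∞] 0ℓ
sum = foldr _+_ 0#

-- The sum of an arbitrary family of non-negative numbers: the supremum of
-- its sums over finite lists without repetitions.
∑ : (X : Setoid a e) → (Setoid.Carrier X → [0,∞] 0ℓ) → [0,∞] (a ⊔ e)
∑ X f .below q = ∃ λ xs → UniqueSetoid.Unique X xs × below (sum (map f xs)) q
∑ X f .negative q<0 = [] , [] , inj₁ q<0
∑ X f .downwards q≤r (xs , u , r<) = xs , u , sum (map f xs) .downwards q≤r r<
∑ X f .rounded (xs , u , q<) =
  let r , q<r , r< = sum (map f xs) .rounded q< in r , q<r , xs , u , r<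

+-cong : ∀ {x x′ y y′} → x ≃ x′ → y ≃ y′ → x + y ≃ x′ + y′
+-cong x≃x′ y≃y′ = mk≃
  (λ (r , s , r< , s< , q≤) → r , s , to x≃x′ r< , to y≃y′ s< , q≤)
  (λ (r , s , r< , s< , q≤) → r , s , from x≃x′ r< , from y≃y′ s< , q≤)

∑-cong : (X : Setoid a e) {f g : Setoid.Carrier X → [0,∞] 0ℓ} →
         (∀ x → f x ≃ g x) → ∑ X f ≃ ∑ X g
∑-cong X {f} {g} f≃g = mk≃
  (λ (xs , u , b) → xs , u , to (go xs) b)
  (λ (xs , u , b) → xs , u , from (go xs) b)
  where
  go : ∀ xs → sum (map f xs) ≃ sum (map g xs)
  go []       = ≃-refl
  go (x ∷ xs) = +-cong (f≃g x) (go xs)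

-- The map into ℕ need not respect _≈_, so this says exactly that the
-- quotient of X by _≈_ is the image of a subset of ℕ.
Countable : Setoid a e → Set (a ⊔ e)
Countable X = ∃ λ (f : Carrier → ℕ) → Injective _≈_ _≡_ f
  where open Setoid X

restrict : (X : Setoid a e) → Pred (Setoid.Carrier X) p → Setoid (a ⊔ p) e
restrict X P = On.setoid X (proj₁ {B = P})

-- Values lie in [0,1] because they are bounded by their sum.
record Distr (X : Setoid a e) : Set (a ⊔ e ⊔ 1ℓ) where
  open Setoid X
  field
    prob      : Carrier → [0,∞] 0ℓ
    prob-cong : ∀ {x y} → x ≈ y → prob x ≃ prob y
    prob-sum  : ∑ X prob ≃ 1#

open Distr public

distrSetoid : Setoid a e → Setoid (a ⊔ e ⊔ 1ℓ) a
distrSetoid X = record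
  { Carrier       = Distr X
  ; _≈_           = λ μ ν → ∀ x → prob μ x ≃ prob ν x
  ; isEquivalence = record
    { refl  = λ _ → ≃-refl
    ; sym   = λ μ≈ν x → ≃-sym (μ≈ν x)
    ; trans = λ μ≈ν ν≈ξ x → ≃-trans (μ≈ν x) (ν≈ξ x)
    }
  }

Distribution : Set → Set₁
Distribution S = Distr (≡.setoid S)

infix 4 _≈ᵈ_
_≈ᵈ_ : {S : Set} → Distribution S → Distribution S → Set
_≈ᵈ_ {S} = Setoid._≈_ (distrSetoid (≡.setoid S))

mass : {S : Set} → Distribution S → Pred S ℓ → [0,∞] ℓ
mass {S = S} μ C = ∑ (restrict (≡.setoid S) C) (prob μ ∘ proj₁)

mass-cong : {S : Set} (μ ν : Distribution S) (C : Pred S ℓ) → μ ≈ᵈ ν → mass μ C ≃ mass ν C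
mass-cong μ ν C μ≈ν = ∑-cong (restrict (≡.setoid _) C) (μ≈ν ∘ proj₁)

-- The classes of R are the sets R s.
infix 4 _≡[_]_
_≡[_]_ : {S : Set} → Distribution S → Rel S ℓ → Distribution S → Set ℓ
μ ≡[ R ] ν = ∀ s → mass μ (R s) ≃ mass ν (R s)

dirac : {S : Set} → S → Distribution S
dirac t .prob s = 𝟏[ s ≡ t ]
dirac t .prob-cong refl = ≃-refl
dirac {S} t .prob-sum = mk≃ (λ (xs , u , b) → upper xs u b) lower
  where
  open UniqueSetoid (≡.setoid S) using (Unique)

  f : S → [0,∞] 0ℓ
  f s = 𝟏[ s ≡ t ]

  zeros : ∀ xs → All (t ≢_) xs → ∀ {q} → below (sum (map f xs)) q → q < 0ℚ
  zeros [] [] (inj₁ q<0) = q<0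
  zeros (x ∷ xs) (t≢x ∷ t∉) (r , s , inj₁ r<0 , b , q≤) =
    ℚ.≤-<-trans q≤ (ℚ.+-mono-< r<0 (zeros xs t∉ b))
  zeros (x ∷ xs) (t≢x ∷ t∉) (r , s , inj₂ (_ , x≡t) , b , q≤) = contradiction (sym x≡t) t≢x

  upper : ∀ xs → Unique xs → ∀ {q} → below (sum (map f xs)) q → below 1# q
  upper [] u (inj₁ q<0) = inj₁ q<0
  upper (x ∷ xs) (x∉ ∷ u) (r , s , inj₂ (r<1 , refl) , b , q≤) =
    inj₂ (ℚ.≤-<-trans q≤ (ℚ.+-mono-< r<1 (zeros xs x∉ b)) , tt)
  upper (x ∷ xs) (x∉ ∷ u) (r , s , inj₁ r<0 , b , q≤) with upper xs u b
  ... | inj₁ s<0       = inj₁ (ℚ.≤-<-trans q≤ (ℚ.+-mono-< r<0 s<0))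
  ... | inj₂ (s<1 , _) = inj₂ (ℚ.≤-<-trans q≤ (ℚ.+-mono-< r<0 s<1) , tt)

  lower : ∀ {q} → below 1# q → below (∑ (≡.setoid S) f) q
  lower (inj₁ q<0) = [] , [] , inj₁ q<0
  lower {q} (inj₂ (q<1 , _)) =
    let r , q<r , r<1 = ℚ.<-dense q<1
        q-r<0 = subst (q ℚ.- r <_) (ℚ.+-inverseʳ r)
                  (ℚ.+-mono-<-≤ q<r (ℚ.≤-refl {ℚ.- r}))
        q≡ = trans (sym (ℚ.+-identityʳ q))
               (trans (cong (q ℚ.+_) (sym (ℚ.+-inverseˡ r)))
                 (trans (sym (ℚ.+-assoc q (ℚ.- r) r)) (ℚ.+-comm (q ℚ.- r) r)))
    in  t ∷ [] , [] ∷ []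
      , r , q ℚ.- r , inj₂ (r<1 , refl) , inj₁ q-r<0 , ℚ.≤-reflexive q≡

Transition : Set → Set → Set₁
Transition S L = S × L × Distribution S

transitionSetoid : (S L : Set) → Setoid 1ℓ 0ℓ
transitionSetoid S L = ×-setoid (≡.setoid S) (×-setoid (≡.setoid L) (distrSetoid (≡.setoid S)))

RespectsEq : {S L : Set} → Pred (Transition S L) 1ℓ → Set₁
RespectsEq {S} {L} Δ = Δ Respects Setoid._≈_ (transitionSetoid S L)

record PA (L : Set) (τ : L) : Set₂ where
  field
    State            : Set
    init             : State
    Δ                : Pred (Transition State L) 1ℓ
    Δ-resp           : RespectsEq Δ
    State-countable  : Countable (≡.setoid State)
    Action-countable : Countable (≡.setoid L)
    Δ-countable      : Countable (restrict (transitionSetoid State L) Δ)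

module _ {L : Set} {τ : L} (𝒜 : PA L τ) where
  open PA 𝒜

  infixl 5 _▷⟨_⟩[_,_]

  -- Finite paths from a given first to a given last state.
  data Path (s : State) : State → Set₁ where
    start      : Path s s
    _▷⟨_⟩[_,_] : ∀ {u b μ} → Path s u → (u , b , μ) ∈ Δ →
                 ∀ t → Positive (prob μ t) → Path s t

  -- The steps (aᵢ, μᵢ, sᵢ) of a path, the last one first.
  steps : ∀ {s t} → Path s t → List (L × Distribution State × State)
  steps start                          = []
  steps (_▷⟨_⟩[_,_] {_} {b} {μ} π _ t _) = (b , μ , t) ∷ steps π

  pathSetoid : State → State → Setoid 1ℓ 1ℓ
  pathSetoid s t = On.setoid (Pointwise.setoid stepSetoid) (steps {s} {t})
    where
    stepSetoid : Setoid 1ℓ 0ℓ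
    stepSetoid = ×-setoid (≡.setoid L) (×-setoid (distrSetoid (≡.setoid State)) (≡.setoid State))

  -- {⊥} ∪ Δ, with ⊥ represented by nothing.
  choiceSetoid : Setoid 1ℓ 1ℓ
  choiceSetoid = MaybePointwise.setoid (restrict (transitionSetoid State L) Δ)

  record Scheduler : Set₁ where
    field
      choose      : ∀ {s t} → Path s t → Distr choiceSetoid
      choose-cong : ∀ {s t} {π π′ : Path s t} → Setoid._≈_ (pathSetoid s t) π π′ →
                    Setoid._≈_ (distrSetoid choiceSetoid) (choose π) (choose π′)
      enabled     : ∀ {s t u b μ} (π : Path s t) (d : (u , b , μ) ∈ Δ) →
                    Positive (prob (choose π) (just (_ , d))) → u ≡ t

    stop : ∀ {s t} → Path s t → [0,∞] 0ℓ
    stop π = prob (choose π) nothing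

    pathProb : ∀ {s t} → Path s t → [0,∞] 0ℓ
    pathProb start = 1#
    pathProb (_▷⟨_⟩[_,_] {μ = μ} π d t _) =
      pathProb π * prob (choose π) (just (_ , d)) * prob μ t

    Scheduled : ∀ {s t} → Path s t → Set
    Scheduled start = ⊤
    Scheduled (π ▷⟨ d ⟩[ _ , _ ]) = Scheduled π × Positive (prob (choose π) (just (_ , d)))

    Maximal : ∀ {s t} → Path s t → Set
    Maximal π = Scheduled π × Positive (stop π)

    final : State → State → [0,∞] 1ℓ
    final s s′ = ∑ (restrict (pathSetoid s s′) Maximal) (λ (π , _) → pathProb π * stop π)

  open Scheduler

  BranchingPath : Rel State 1ℓ → L → ∀ {s t} → Path s t → Set₁
  BranchingPath R a start = Lift 1ℓ ⊥
  BranchingPath R a {s} (_▷⟨_⟩[_,_] {b = b} π _ _ _) =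
    b ≡ a × All (λ (aᵢ , _ , sᵢ) → aᵢ ≡ τ × R s sᵢ) (steps π)

  BranchingStep : Rel State 1ℓ → State → L → Distribution State → Set₁
  BranchingStep R s a μ =
      (a ≡ τ × μ ≈ᵈ dirac s)
    ⊎ (∃ λ 𝒮 → (∀ s′ → final 𝒮 s s′ ≃ prob μ s′)
             × (∀ {t} (π : Path s t) → Maximal 𝒮 π → BranchingPath R a π))

  record IsBranchingBisimulation (R : Rel State 1ℓ) : Set₁ where
    field
      isEquivalence : IsEquivalence R
      transfer      : ∀ {s t} → R s t → ∀ {a μ} → (s , a , μ) ∈ Δ →
                      ∃ λ μ′ → BranchingStep R t a μ′ × μ ≡[ R ] μ′

  BisimilarStates : State → State → Set₂
  BisimilarStates p q = ∃ λ R → IsBranchingBisimulation R × R p q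

code⊎ : ℕ ⊎ ℕ → ℕ
code⊎ (inj₁ n) = 2 ℕ.* n
code⊎ (inj₂ n) = ℕ.suc (2 ℕ.* n)

code⊎-injective : ∀ x y → code⊎ x ≡ code⊎ y → x ≡ y
code⊎-injective (inj₁ m) (inj₁ n) eq = cong inj₁ (ℕ.*-cancelˡ-≡ m n 2 eq)
code⊎-injective (inj₁ m) (inj₂ n) eq = contradiction eq (ℕ.even≢odd m n)
code⊎-injective (inj₂ m) (inj₁ n) eq = contradiction (sym eq) (ℕ.even≢odd n m)
code⊎-injective (inj₂ m) (inj₂ n) eq = cong inj₂ (ℕ.*-cancelˡ-≡ m n 2 (ℕ.suc-injective eq))

-- The disjoint union, with the initial state of the first automaton.
module _ {L : Set} {τ : L} where

  infixr 1 _⊎ᴾᴬ_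

  _⊎ᴾᴬ_ : PA L τ → PA L τ → PA L τ
  𝒜 ⊎ᴾᴬ ℬ = record
    { State            = State
    ; init             = inj₁ A.init
    ; Δ                = Δ
    ; Δ-resp           = λ {t} {t′} → resp {t} {t′}
    ; State-countable  = code⊎ ∘ codeS , λ {s} {t} → codeS-injective s t ∘ code⊎-injective _ _
    ; Action-countable = A.Action-countable
    ; Δ-countable      = code⊎ ∘ codeΔ , λ {t} {t′} → codeΔ-injective t t′ ∘ code⊎-injective _ _
    }
    module DisjointUnion where
    module A = PA 𝒜
    module B = PA ℬ

    State : Set
    State = A.State ⊎ B.State

    Δ : Pred (Transition State L) 1ℓ
    Δ (inj₁ s , a , μ) = ∃ λ μ₁ → (s , a , μ₁) ∈ A.Δ
                       × (∀ x → prob μ (inj₁ x) ≃ prob μ₁ x) × (∀ y → prob μ (inj₂ y) ≃ 0#)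
    Δ (inj₂ s , a , μ) = ∃ λ μ₂ → (s , a , μ₂) ∈ B.Δ
                       × (∀ x → prob μ (inj₁ x) ≃ 0#) × (∀ y → prob μ (inj₂ y) ≃ prob μ₂ y)

    resp : RespectsEq Δ
    resp {inj₁ _ , _} (refl , refl , μ≈ν) (μ₁ , d , f , g) =
      μ₁ , d , (λ x → ≃-trans (≃-sym (μ≈ν (inj₁ x))) (f x)) ,
      (λ y → ≃-trans (≃-sym (μ≈ν (inj₂ y))) (g y))
    resp {inj₂ _ , _} (refl , refl , μ≈ν) (μ₂ , d , f , g) =
      μ₂ , d , (λ x → ≃-trans (≃-sym (μ≈ν (inj₁ x))) (f x)) ,
      (λ y → ≃-trans (≃-sym (μ≈ν (inj₂ y))) (g y))

    codeS : State → ℕ ⊎ ℕ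
    codeS = Sum.map (proj₁ A.State-countable) (proj₁ B.State-countable)

    codeS-injective : ∀ s t → codeS s ≡ codeS t → s ≡ t
    codeS-injective (inj₁ s) (inj₁ t) eq = cong inj₁ (proj₂ A.State-countable (inj₁-injective eq))
    codeS-injective (inj₂ s) (inj₂ t) eq = cong inj₂ (proj₂ B.State-countable (inj₂-injective eq))

    ΔSetoid : Setoid 1ℓ 0ℓ
    ΔSetoid = restrict (transitionSetoid State L) Δ

    open Setoid ΔSetoid using (Carrier; _≈_)

    codeΔ : Carrier → ℕ ⊎ ℕ
    codeΔ ((inj₁ _ , _) , μ₁ , d , _) = inj₁ (proj₁ A.Δ-countable (_ , d))
    codeΔ ((inj₂ _ , _) , μ₂ , d , _) = inj₂ (proj₁ B.Δ-countable (_ , d))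

    codeΔ-injective : ∀ t t′ → codeΔ t ≡ codeΔ t′ → t ≈ t′
    codeΔ-injective ((inj₁ _ , _) , _ , d , f , g) ((inj₁ _ , _) , _ , d′ , f′ , g′) eq
      with s≡ , a≡ , μ≈ ← proj₂ A.Δ-countable {_ , d} {_ , d′} (inj₁-injective eq)
      = cong inj₁ s≡ , a≡ , λ where
          (inj₁ x) → ≃-trans (f x) (≃-trans (μ≈ x) (≃-sym (f′ x)))
          (inj₂ y) → ≃-trans (g y) (≃-sym (g′ y))
    codeΔ-injective ((inj₂ _ , _) , _ , d , f , g) ((inj₂ _ , _) , _ , d′ , f′ , g′) eq
      with s≡ , a≡ , μ≈ ← proj₂ B.Δ-countable {_ , d} {_ , d′} (inj₂-injective eq)
      = cong inj₂ s≡ , a≡ , λ where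
          (inj₁ x) → ≃-trans (f x) (≃-sym (f′ x))
          (inj₂ y) → ≃-trans (g y) (≃-trans (μ≈ y) (≃-sym (g′ y)))

  Bisimilar : PA L τ → PA L τ → Set₂
  Bisimilar 𝒜 ℬ = BisimilarStates (𝒜 ⊎ᴾᴬ ℬ) (inj₁ (PA.init 𝒜)) (inj₂ (PA.init ℬ))

module _ {L : Set} {τ : L} (𝒜 : PA L τ) (c : Pred (Transition (PA.State 𝒜) L) 1ℓ) where
  open PA 𝒜

  record IsDeterministicτSet : Set₁ where
    field
      respects      : RespectsEq c
      transition    : c ⊆ Δ
      internal      : ∀ {s a μ} → (s , a , μ) ∈ c → a ≡ τ
      deterministic : ∀ {s a μ} → (s , a , μ) ∈ c → ∃ λ t → μ ≈ᵈ dirac t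

  infix 4 _→c_ _↠c_

  _→c_ : Rel State 1ℓ
  s →c t = (s , τ , dirac t) ∈ c

  _↠c_ : Rel State 1ℓ
  _↠c_ = Star _→c_

  R[c] : Rel State 1ℓ
  R[c] s s′ = ∃ λ u → s ↠c u × s′ ↠c u

  record IsConfluent : Set₁ where
    field
      isEquivalence : IsEquivalence R[c]
      confluent     : ∀ {s t} → s ↠c t → ∀ {a μ} → (s , a , μ) ∈ Δ →
                      (∃ λ ν → (t , a , ν) ∈ Δ × μ ≡[ R[c] ] ν)
                      ⊎ (a ≡ τ × μ ≡[ R[c] ] dirac t)

  record IsRepresentationMap (φ : State → State) : Set₁ where
    field
      constant  : ∀ {s s′} → s →c s′ → φ s ≡ φ s′
      reachable : ∀ s → s ↠c φ s

  reduced : (State → State) → PA L τ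
  reduced φ = record
    { State            = State/φ
    ; init             = φ init , [ init , refl ]
    ; Δ                = Δ/φ
    ; Δ-resp           = λ {t} {t′} → resp {t} {t′}
    ; State-countable  = proj₁ State-countable ∘ value ,
                         λ {s} {t} eq → value-injective s t (proj₂ State-countable eq)
    ; Action-countable = Action-countable
    ; Δ-countable      = codeΔ , λ {t} {t′} → codeΔ-injective t t′
    }
    module Reduced where
    -- The image of φ; its elements are equal when their values are, since
    -- the membership proof is irrelevant.
    State/φ : Set
    State/φ = [ x ∈ State ∣ ∃ (λ s → φ s ≡ x) ]

    value-injective : (x y : State/φ) → value x ≡ value y → x ≡ y
    value-injective (_ , _) (_ , _) refl = refl

    Δ/φ : Pred (Transition State/φ L) 1ℓ
    Δ/φ (s , a , μ) = ∃₂ λ t μ′ →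
      (t , a , μ′) ∈ Δ × (t , a , μ′) ∉ c × φ t ≡ value s ×
      (∀ s′ → prob μ s′ ≃ mass μ′ (λ s″ → φ s″ ≡ value s′))

    resp : RespectsEq Δ/φ
    resp (refl , refl , μ≈ν) (t , μ′ , d , d∉c , φt≡ , h) =
      t , μ′ , d , d∉c , φt≡ , λ s′ → ≃-trans (≃-sym (μ≈ν s′)) (h s′)

    ΔSetoid : Setoid 1ℓ 0ℓ
    ΔSetoid = restrict (transitionSetoid State/φ L) Δ/φ

    open Setoid ΔSetoid using (Carrier; _≈_)

    codeΔ : Carrier → ℕ
    codeΔ (_ , _ , _ , d , _) = proj₁ Δ-countable (_ , d)

    codeΔ-injective : ∀ t t′ → codeΔ t ≡ codeΔ t′ → t ≈ t′
    codeΔ-injective ((s , _ , μ) , t , μ′ , d , _ , φt , h) ((s₁ , _ , μ₁) , t₁ , μ₁′ , d₁ , _ , φt₁ , h₁) eq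
      with t≡ , a≡ , μ≈ ← proj₂ Δ-countable {_ , d} {_ , d₁} eq
      = value-injective s s₁ (trans (sym φt) (trans (cong φ t≡) φt₁)) , a≡ ,
        λ s′ → ≃-trans (h s′) (≃-trans
          (mass-cong μ′ μ₁′ (λ s″ → φ s″ ≡ value s′) μ≈) (≃-sym (h₁ s′)))

{-# OPTIONS --safe #-}

-- In the disjoint union, relate states with the same representative.  The
-- classes of R_c are the fibres of φ, so summing a distribution over the fibres
-- of a map that preserves representatives does not change the mass of any
-- class; hence every transition of the union comes from a transition of
-- some s in 𝒜.  Confluence along s ↠ φ(s) gives either an inert step or a transition of
-- φ(s) to an equivalent distribution.  A state of 𝒜 answers by walking along
-- c-steps to φ(s) first, a state of the quotient by the transition induced by
-- that of φ(s), or by staying put when the latter lies in c.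

module Submission where

open import Defs
open import Axiom.ExcludedMiddle using (ExcludedMiddle)
open import Relation.Unary using (Pred)

open import Data.Irrelevant using ([_])
open import Data.List.Base using (List; []; _∷_; _++_; map; filter; length)
open import Data.List.Membership.Propositional using (_∈_)
open import Data.List.Membership.Propositional.Properties using (∈-map⁺; ∈-deduplicate⁺)
open import Data.List.Properties using (map-∘; map-++)
open import Data.List.Relation.Binary.Pointwise as Pointwise using ([]; _∷_)
open import Data.List.Relation.Unary.All as All using (All; []; _∷_)
import Data.List.Relation.Unary.All.Properties as All
open import Data.List.Relation.Unary.AllPairs using ([]; _∷_)
import Data.List.Relation.Unary.AllPairs.Properties as AllPairs
open import Data.List.Relation.Unary.Any using (here; there)
import Data.List.Relation.Unary.Unique.DecPropositional.Properties as DecUnique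
open import Data.List.Relation.Unary.Unique.Propositional using (Unique)
import Data.List.Relation.Unary.Unique.Propositional.Properties as Unique
import Data.List.Relation.Unary.Unique.Setoid as UniqueSetoid
open import Data.Maybe.Base using (Maybe; just; nothing)
open import Data.Maybe.Relation.Binary.Pointwise using (just; nothing)
open import Data.Nat.Base as ℕ using (ℕ; zero; suc; z≤n)
import Data.Nat.Properties as ℕ
open import Data.Product.Base using (∃; ∃₂; _×_; _,_; proj₁; proj₂)
open import Data.Product.Relation.Binary.Pointwise.NonDependent using (×-setoid)
open import Data.Rational.Base as ℚ using (ℚ; 0ℚ; 1ℚ; _<_; _≤_)
import Data.Rational.Properties as ℚ
open import Data.Refinement.Base using (value; _,_)
open import Data.Sum.Base using (_⊎_; inj₁; inj₂; [_,_]′)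
open import Data.Sum.Properties using (inj₁-injective; inj₂-injective)
open import Data.Unit.Base using (⊤; tt)
open import Function.Base using (_∘_; id)
open import Level using (Level; Lift; lift; 0ℓ; _⊔_)
open import Relation.Binary.Bundles using (Setoid)
open import Relation.Binary.Construct.Closure.ReflexiveTransitive as Star using (Star; ε; _◅_)
open import Relation.Binary.Core using (Rel)
open import Relation.Binary.Definitions using (DecidableEquality; tri<; tri≈; tri>)
open import Relation.Binary.PropositionalEquality.Core
  using (_≡_; _≢_; refl; sym; trans; cong; subst)
import Relation.Binary.PropositionalEquality.Properties as ≡
open import Relation.Binary.Structures using (IsEquivalence)
open import Relation.Nullary.Decidable.Core
  using (Dec; yes; no; ¬?; True; toWitness; fromWitness; map′; recompute)
open import Relation.Nullary.Negation using (¬_; contradiction)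

private
  variable
    a e p ℓ ℓ₁ ℓ₂ ℓ₃ : Level

-- Order and arithmetic of extended non-negative numbers

infix 4 _≼_

record _≼_ (x : [0,∞] ℓ₁) (y : [0,∞] ℓ₂) : Set (ℓ₁ ⊔ ℓ₂) where
  constructor mk≼
  field at : ∀ {q} → below x q → below y q

open _≼_

≼-refl : {x : [0,∞] ℓ} → x ≼ x
≼-refl = mk≼ id

≼-trans : {x : [0,∞] ℓ₁} {y : [0,∞] ℓ₂} {z : [0,∞] ℓ₃} → x ≼ y → y ≼ z → x ≼ z
≼-trans (mk≼ f) (mk≼ g) = mk≼ (g ∘ f)

≃⇒≼ : {x : [0,∞] ℓ₁} {y : [0,∞] ℓ₂} → x ≃ y → x ≼ y
≃⇒≼ (mk≃ f g) = mk≼ f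

≼-antisym : {x : [0,∞] ℓ₁} {y : [0,∞] ℓ₂} → x ≼ y → y ≼ x → x ≃ y
≼-antisym (mk≼ f) (mk≼ g) = mk≃ f g

-- Every cut contains all negative rationals, so a comparison of two numbers only needs an argument
-- when the smaller one is positive.
negative⊎positive : (x : [0,∞] ℓ) → ∀ {q} → below x q → q < 0ℚ ⊎ Positive x
negative⊎positive x {q} b with q ℚ.<? 0ℚ
... | yes q<0 = inj₁ q<0
... | no  q≮0 = inj₂ (x .downwards (ℚ.≮⇒≥ q≮0) b)

¬positive⇒≃0 : {x : [0,∞] ℓ} → ¬ Positive x → x ≃ 0#
¬positive⇒≃0 {x = x} ¬p = mk≃
  (λ b → [ inj₁ , (λ p → contradiction p ¬p) ]′ (negative⊎positive x b))
  λ { (inj₁ q<0) → x .negative q<0 }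

𝟏-true : {P : Set} → P → 𝟏[ P ] ≃ 1#
𝟏-true h = mk≃ (λ { (inj₁ q<0) → inj₁ q<0 ; (inj₂ (q<1 , _)) → inj₂ (q<1 , tt) })
               (λ { (inj₁ q<0) → inj₁ q<0 ; (inj₂ (q<1 , _)) → inj₂ (q<1 , h) })

𝟏-holds : {P : Set} → Positive 𝟏[ P ] → P
𝟏-holds (inj₁ 0<0)     = contradiction 0<0 (ℚ.<-irrefl refl)
𝟏-holds (inj₂ (_ , h)) = h

𝟏-cong : {P Q : Set} → (P → Q) → (Q → P) → 𝟏[ P ] ≃ 𝟏[ Q ]
𝟏-cong f g = mk≃ (λ { (inj₁ q<0) → inj₁ q<0 ; (inj₂ (q<1 , h)) → inj₂ (q<1 , f h) })
                 (λ { (inj₁ q<0) → inj₁ q<0 ; (inj₂ (q<1 , h)) → inj₂ (q<1 , g h) })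

𝟏-positive : {P : Set} → P → Positive 𝟏[ P ]
𝟏-positive h = inj₂ (ℚ.positive⁻¹ 1ℚ , h)

+-mono-≼ : ∀ x x′ y y′ → x ≼ x′ → y ≼ y′ → x + y ≼ x′ + y′
+-mono-≼ _ _ _ _ (mk≼ f) (mk≼ g) = mk≼ λ (r , s , r< , s< , q≤) → r , s , f r< , g s< , q≤

+-comm : ∀ x y → x + y ≃ y + x
+-comm x y = mk≃ (go {x} {y}) (go {y} {x})
  where
  go : ∀ {x y q} → below (x + y) q → below (y + x) q
  go (r , s , r< , s< , q≤) = s , r , s< , r< , ℚ.≤-trans q≤ (ℚ.≤-reflexive (ℚ.+-comm r s))

+-assoc : ∀ x y z → (x + y) + z ≃ x + (y + z)
+-assoc x y z = mk≃
  (λ (u , t , (r , s , r< , s< , u≤) , t< , q≤) →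
    r , s ℚ.+ t , r< , (s , t , s< , t< , ℚ.≤-refl) ,
    ℚ.≤-trans q≤ (ℚ.≤-trans (ℚ.+-monoˡ-≤ t u≤) (ℚ.≤-reflexive (ℚ.+-assoc r s t))))
  (λ (r , u , r< , (s , t , s< , t< , u≤) , q≤) →
    r ℚ.+ s , t , (r , s , r< , s< , ℚ.≤-refl) , t< ,
    ℚ.≤-trans q≤ (ℚ.≤-trans (ℚ.+-monoʳ-≤ r u≤) (ℚ.≤-reflexive (sym (ℚ.+-assoc r s t)))))

+-congˡ : ∀ x {y y′} → y ≃ y′ → x + y ≃ x + y′
+-congˡ x = +-cong (≃-refl {x = x})

+-congʳ : ∀ y {x x′} → x ≃ x′ → x + y ≃ x′ + y
+-congʳ y x≃x′ = +-cong x≃x′ (≃-refl {x = y})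

+-swap : ∀ x y z → x + (y + z) ≃ y + (x + z)
+-swap x y z = ≃-trans (≃-sym (+-assoc x y z)) (≃-trans (+-congʳ z (+-comm x y)) (+-assoc y x z))

+-identityʳ : ∀ x → x + 0# ≃ x
+-identityʳ x = mk≃
  (λ { (r , s , r< , inj₁ s<0 , q≤) → x .downwards
         (ℚ.≤-trans q≤ (ℚ.≤-trans (ℚ.+-monoʳ-≤ r (ℚ.<⇒≤ s<0)) (ℚ.≤-reflexive (ℚ.+-identityʳ r)))) r< })
  -- Roundedness leaves room above `q`: with `r` still below `x`, the negative gap `q - r` serves as
  -- the summand below 0.
  (λ {q} q< → let r , q<r , r< = x .rounded q< in
    r , q ℚ.- r , r< ,
    inj₁ (subst (q ℚ.- r <_) (ℚ.+-inverseʳ r) (ℚ.+-monoˡ-< (ℚ.- r) q<r)) ,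
    ℚ.≤-reflexive (sym (trans (ℚ.+-comm r (q ℚ.- r)) (trans (ℚ.+-assoc q (ℚ.- r) r)
      (trans (cong (q ℚ.+_) (ℚ.+-inverseˡ r)) (ℚ.+-identityʳ q))))))

+-identityˡ : ∀ x → 0# + x ≃ x
+-identityˡ x = ≃-trans (+-comm 0# x) (+-identityʳ x)

*-cong : ∀ {x x′ y y′} → x ≃ x′ → y ≃ y′ → x * y ≃ x′ * y′
*-cong x≃x′ y≃y′ = mk≃
  (λ { (inj₁ q<0) → inj₁ q<0
     ; (inj₂ (r , s , (0≤r , r<) , (0≤s , s<) , q≤)) →
         inj₂ (r , s , (0≤r , to x≃x′ r<) , (0≤s , to y≃y′ s<) , q≤) })
  (λ { (inj₁ q<0) → inj₁ q<0
     ; (inj₂ (r , s , (0≤r , r<) , (0≤s , s<) , q≤)) →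
         inj₂ (r , s , (0≤r , from x≃x′ r<) , (0≤s , from y≃y′ s<) , q≤) })

*-comm : ∀ x y → x * y ≃ y * x
*-comm x y = mk≃ (go {x} {y}) (go {y} {x})
  where
  go : ∀ {x y q} → below (x * y) q → below (y * x) q
  go (inj₁ q<0) = inj₁ q<0
  go (inj₂ (r , s , hr , hs , q≤)) =
    inj₂ (s , r , hs , hr , ℚ.≤-trans q≤ (ℚ.≤-reflexive (ℚ.*-comm r s)))

*-identityʳ : ∀ x → x * 1# ≃ x
*-identityʳ x = mk≃ forth back
  where
  forth : ∀ {q} → below (x * 1#) q → below x q
  forth (inj₁ q<0) = x .negative q<0
  forth (inj₂ (r , s , (0≤r , r<) , (0≤s , inj₁ s<0) , q≤)) =
    contradiction (ℚ.≤-<-trans 0≤s s<0) (ℚ.<-irrefl refl)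
  forth (inj₂ (r , s , (0≤r , r<) , (0≤s , inj₂ (s<1 , _)) , q≤)) = x .downwards
    (ℚ.≤-trans q≤ (ℚ.≤-trans (ℚ.*-monoˡ-≤-nonNeg r {{ℚ.nonNegative 0≤r}} (ℚ.<⇒≤ s<1))
                             (ℚ.≤-reflexive (ℚ.*-identityʳ r)))) r<

  back : ∀ {q} → below x q → below (x * 1#) q
  back {q} q< with q ℚ.<? 0ℚ
  ... | yes q<0 = inj₁ q<0
  -- Factor `q` as `r` times `q / r`, where `r` comes from roundedness; `q < r` makes the second
  -- factor less than 1.
  ... | no  q≮0 = inj₂ (r , r⁻¹ ℚ.* q , (ℚ.<⇒≤ 0<r , r<) , (0≤r⁻¹q , inj₂ (r⁻¹q<1 , tt)) ,
                        ℚ.≤-reflexive (sym (trans (sym (ℚ.*-assoc r r⁻¹ q))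
                          (trans (cong (ℚ._* q) (ℚ.*-inverseʳ r)) (ℚ.*-identityˡ q)))))
    where
    r = proj₁ (x .rounded q<)
    q<r = proj₁ (proj₂ (x .rounded q<))
    r< = proj₂ (proj₂ (x .rounded q<))
    0≤q = ℚ.≮⇒≥ q≮0
    0<r = ℚ.≤-<-trans 0≤q q<r
    instance
      _ = ℚ.positive 0<r
      _ = ℚ.pos⇒nonZero r
    r⁻¹ = ℚ.1/ r
    instance
      _ = ℚ.1/pos⇒pos r
      _ = ℚ.pos⇒nonNeg r⁻¹
    0≤r⁻¹q = subst (_≤ r⁻¹ ℚ.* q) (ℚ.*-zeroʳ r⁻¹) (ℚ.*-monoˡ-≤-nonNeg r⁻¹ 0≤q)
    r⁻¹q<1 = subst (r⁻¹ ℚ.* q <_) (ℚ.*-inverseˡ r) (ℚ.*-monoʳ-<-pos r⁻¹ q<r)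

*-identityˡ : ∀ x → 1# * x ≃ x
*-identityˡ x = ≃-trans (*-comm 1# x) (*-identityʳ x)

sum-++ : ∀ xs ys → sum (xs ++ ys) ≃ sum xs + sum ys
sum-++ []       ys = ≃-sym (+-identityˡ (sum ys))
sum-++ (x ∷ xs) ys = ≃-trans (+-congˡ x (sum-++ xs ys)) (≃-sym (+-assoc x (sum xs) (sum ys)))

-- Sums over subsets and fibres, and image distributions

total : {S : Set} → (S → [0,∞] 0ℓ) → Pred S ℓ → [0,∞] ℓ
total {S = S} f C = ∑ (restrict (≡.setoid S) C) (f ∘ proj₁)

module _ {S : Set} (f : S → [0,∞] 0ℓ) where

  Σ[_] : List S → [0,∞] 0ℓ
  Σ[ xs ] = sum (map f xs)

  -- Equality in the restricted setoid ignores membership proofs, so uniqueness passes to the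
  -- underlying values and the proofs can be kept in a separate `All`. With `total⁺` this reduces
  -- sums over a subset to lists of plain elements; `mass μ` is `total (prob μ)`.
  total⁻ : {C : Pred S ℓ} → ∀ {q} → below (total f C) q →
           ∃ λ xs → Unique xs × All C xs × below Σ[ xs ] q
  total⁻ (zs , u , b) =
    map proj₁ zs , AllPairs.map⁺ u , All.map⁺ (All.universal proj₂ zs) ,
    subst (λ ys → below (sum ys) _) (map-∘ zs) b

  total⁺ : {C : Pred S ℓ} → ∀ {xs q} → Unique xs → All C xs → below Σ[ xs ] q → below (total f C) q
  total⁺ {C = C} u c b =
    All.toList c ,
    AllPairs.map⁻ {f = proj₁} (subst Unique (sym (values c)) u) ,
    subst (λ ys → below (sum ys) _) (trans (cong (map f) (sym (values c))) (sym (map-∘ (All.toList c)))) b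
    where
    values : ∀ {xs} (c : All C xs) → map proj₁ (All.toList c) ≡ xs
    values []       = refl
    values (_ ∷ cs) = cong (_ ∷_) (values cs)

  total-mono : {C : Pred S ℓ₁} {D : Pred S ℓ₂} → (∀ {x} → C x → D x) → total f C ≼ total f D
  total-mono C⊆D = mk≼ λ b → let _ , u , c , b′ = total⁻ b in total⁺ u (All.map C⊆D c) b′

  total-cong : {C : Pred S ℓ₁} {D : Pred S ℓ₂} → (∀ {x} → C x → D x) → (∀ {x} → D x → C x) →
               total f C ≃ total f D
  total-cong C⊆D D⊆C = ≼-antisym (total-mono C⊆D) (total-mono D⊆C)

  total-∅ : {C : Pred S ℓ} → (∀ {x} → ¬ C x) → total f C ≃ 0#
  total-∅ {C = C} ∅ = ¬positive⇒≃0 {x = total f C} λ b → empty (total⁻ {C = C} b)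
    where
    empty : ¬ (∃ λ xs → Unique xs × All C xs × Positive Σ[ xs ])
    empty ([]    , _ , _      , b) = 𝟏-holds b
    empty (_ ∷ _ , _ , cx ∷ _ , _) = ∅ cx

  total-⊤ : total f (λ _ → ⊤) ≃ ∑ (≡.setoid S) f
  total-⊤ = mk≃
    (λ b → let xs , u , _ , b′ = total⁻ b in xs , u , b′)
    (λ (xs , u , b) → total⁺ u (All.universal (λ _ → tt) xs) b)

  Σ-filter : {P : Pred S p} (P? : ∀ x → Dec (P x)) → ∀ xs →
             Σ[ xs ] ≃ Σ[ filter P? xs ] + Σ[ filter (¬? ∘ P?) xs ]
  Σ-filter P? []       = ≃-sym (+-identityˡ 0#)
  Σ-filter P? (x ∷ xs) with P? x | Σ-filter P? xs
  ... | yes _ | ih = ≃-trans (+-congˡ (f x) ih)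
    (≃-sym (+-assoc (f x) Σ[ filter P? xs ] Σ[ filter (¬? ∘ P?) xs ]))
  ... | no  _ | ih = ≃-trans (+-congˡ (f x) ih)
    (+-swap (f x) Σ[ filter P? xs ] Σ[ filter (¬? ∘ P?) xs ])

fibreTotal : {X Y : Set} → (X → Y) → (X → [0,∞] 0ℓ) → Y → [0,∞] 0ℓ
fibreTotal g f y = total f (λ x → g x ≡ y)

module _ {X Y : Set} (_≟_ : DecidableEquality Y) (g : X → Y) (f : X → [0,∞] 0ℓ) where

  private
    fibre : Y → [0,∞] 0ℓ
    fibre = fibreTotal g f

    -- Induction on `ys`: the entries of `xs` lying over `y` form one of the finite lists bounded by
    -- the fibre total, and the images of the remaining entries lie in the tail.
    split : ∀ ys xs → Unique xs → All (λ x → g x ∈ ys) xs → Σ[_] f xs ≼ Σ[_] fibre ys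
    split []       []       _ _ = ≼-refl
    split []       (_ ∷ _)  _ (() ∷ _)
    split (y ∷ ys) xs u c = ≼-trans (≃⇒≼ (Σ-filter f P? xs)) (+-mono-≼
      (Σ[_] f (filter P? xs)) (fibre y) (Σ[_] f (filter (¬? ∘ P?) xs)) (Σ[_] fibre ys)
      (mk≼ (total⁺ f (Unique.filter⁺ P? u) (All.all-filter P? xs)))
      (split ys (filter (¬? ∘ P?) xs) (Unique.filter⁺ (¬? ∘ P?) u)
        (All.zipWith tail (All.filter⁺ (¬? ∘ P?) c , All.all-filter (¬? ∘ P?) xs))))
      where
      P? : ∀ x → Dec (g x ≡ y)
      P? x = g x ≟ y
      tail : ∀ {x} → g x ∈ y ∷ ys × g x ≢ y → g x ∈ ys
      tail (here eq , ≢y)  = contradiction eq ≢y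
      tail (there ∈ys , _) = ∈ys

    -- A value below a finite sum of fibre totals is reached by finitely many elements of each
    -- fibre, and these lists can be concatenated.
    join : ∀ ys → Unique ys → ∀ {q} → below (Σ[_] fibre ys) q →
           ∃ λ xs → Unique xs × All (λ x → g x ∈ ys) xs × below (Σ[_] f xs) q
    join []       _        b = [] , [] , [] , b
    join (y ∷ ys) (y∉ ∷ u) (r , s , r< , s< , q≤) =
      let xs  , u₁ , c₁ , b₁ = total⁻ f r<
          xs′ , u₂ , c₂ , b₂ = join ys u s<
      in  xs ++ xs′
        -- Fibres over distinct points are disjoint: a common element would put `y` into `ys`.
        , Unique.++⁺ u₁ u₂ (λ (∈xs , ∈xs′) → All.lookup y∉
            (subst (_∈ ys) (All.lookup c₁ ∈xs) (All.lookup c₂ ∈xs′)) refl)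
        , All.++⁺ (All.map here c₁) (All.map there c₂)
        , subst (λ zs → below (sum zs) _) (sym (map-++ f xs xs′))
            (from (sum-++ (map f xs) (map f xs′)) (r , s , b₁ , b₂ , q≤))

  total-fibreTotal : {C : Pred Y ℓ} → total (fibreTotal g f) C ≃ total f (C ∘ g)
  total-fibreTotal {C = C} = mk≃
    (λ b → let ys , u  , c  , b₁ = total⁻ fibre b
               xs , u′ , c′ , b₂ = join ys u b₁
           in  total⁺ f u′ (All.map (All.lookup c) c′) b₂)
    (λ b → let xs , u , c , b′ = total⁻ f b in
      -- Distinct entries may share an image, so the list of images is deduplicated before it
      -- indexes a sum of fibres.
      total⁺ fibre (DecUnique.deduplicate-! _≟_ (map g xs))
        (All.deduplicate⁺ _≟_ (All.map⁺ c))
        (at (split _ xs u (All.tabulate (∈-deduplicate⁺ _≟_ ∘ ∈-map⁺ g))) b′))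

  pushforward-sum : ∑ (≡.setoid X) f ≃ 1# → ∑ (≡.setoid Y) (fibreTotal g f) ≃ 1#
  pushforward-sum f≃1 = ≃-trans (≃-sym (total-⊤ fibre)) (≃-trans total-fibreTotal (≃-trans (total-⊤ f) f≃1))

pushforward : {X Y : Set} → DecidableEquality Y → (X → Y) → Distribution X → Distribution Y
pushforward _≟_ g μ .prob             = fibreTotal g (prob μ)
pushforward _≟_ g μ .prob-cong refl   = ≃-refl
pushforward _≟_ g μ .prob-sum         = pushforward-sum _≟_ g (prob μ) (prob-sum μ)

-- A list without repetitions has at most one entry here. An element is demanded only if `v` is
-- positive, since the index set may be empty when `v` is 0, as with the maximal paths to a state of
-- probability 0.
∑-subsingleton : (X : Setoid a e) {f : Setoid.Carrier X → [0,∞] 0ℓ} {v : [0,∞] ℓ} →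
                 (∀ x y → Setoid._≈_ X x y) → (∀ x → f x ≃ v) →
                 (Positive v → Setoid.Carrier X) → ∑ X f ≃ v
∑-subsingleton X {f} {v} ≈-all f≃v point = mk≃ upper lower
  where
  upper : ∀ {q} → below (∑ X f) q → below v q
  upper ([]         , _ , inj₁ q<0)         = v .negative q<0
  upper (x ∷ []     , _ , b)                = to (f≃v x) (to (+-identityʳ (f x)) b)
  upper (x ∷ y ∷ _  , ((x≉y ∷ _) ∷ _) , _)  = contradiction (≈-all x y) x≉y

  lower : ∀ {q} → below v q → below (∑ X f) q
  lower b with negative⊎positive v b
  ... | inj₁ q<0 = ∑ X f .negative q<0
  ... | inj₂ pos = point pos ∷ [] , [] ∷ [] ,
                   from (+-identityʳ (f (point pos))) (from (f≃v (point pos)) b)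

-- Point masses and Dirac distributions

-- Over a setoid whose equality may be a large proposition, 𝟏[_] only applies to its decision.
module _ (X : Setoid a e) (_≟_ : ∀ x y → Dec (Setoid._≈_ X x y)) where
  open Setoid X renaming (Carrier to C; refl to ≈-refl; sym to ≈-sym; trans to ≈-trans)

  private
    indicator : C → C → [0,∞] 0ℓ
    indicator t x = 𝟏[ True (x ≟ t) ]

    indicator-≈ : ∀ {t x} → x ≈ t → indicator t x ≃ 1#
    indicator-≈ {t} {x} x≈t = 𝟏-true {P = True (x ≟ t)} (fromWitness x≈t)

    indicator-≉ : ∀ {t x} → ¬ x ≈ t → indicator t x ≃ 0#
    indicator-≉ x≉t = ¬positive⇒≃0 (x≉t ∘ toWitness ∘ 𝟏-holds)

    zeros : ∀ {t} xs → All (λ x → ¬ x ≈ t) xs → sum (map (indicator t) xs) ≃ 0#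
    zeros []       []         = ≃-refl
    zeros (x ∷ xs) (x≉t ∷ t∉) = ≃-trans (+-cong (indicator-≉ x≉t) (zeros xs t∉)) (+-identityˡ 0#)

    -- If the head equals `t`, uniqueness makes every later term vanish; otherwise the head
    -- contributes nothing.
    indicator-sum≼1 : ∀ {t} xs → UniqueSetoid.Unique X xs → sum (map (indicator t) xs) ≼ 1#
    indicator-sum≼1 []       u        = mk≼ λ { (inj₁ q<0) → inj₁ q<0 }
    indicator-sum≼1 {t} (x ∷ xs) (x∉ ∷ u) = by-cases (x ≟ t)
      where
      rest = sum (map (indicator t) xs)

      by-cases : Dec (x ≈ t) → indicator t x + rest ≼ 1#
      by-cases (yes x≈t) = ≃⇒≼ (≃-trans
        (+-cong (indicator-≈ x≈t)
                (zeros xs (All.map (λ x≉y y≈t → x≉y (≈-trans x≈t (≈-sym y≈t))) x∉)))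
        (+-identityʳ 1#))
      by-cases (no x≉t) = ≼-trans
        (≃⇒≼ (≃-trans (+-congʳ rest (indicator-≉ x≉t)) (+-identityˡ rest)))
        (indicator-sum≼1 xs u)

  pointMass : C → Distr X
  pointMass t .prob = indicator t
  pointMass t .prob-cong {x} {y} x≈y =
    𝟏-cong (λ h → fromWitness (≈-trans (≈-sym x≈y) (toWitness h)))
           (λ h → fromWitness (≈-trans x≈y (toWitness h)))
  pointMass t .prob-sum = mk≃ (λ (xs , u , b) → at (indicator-sum≼1 xs u) b)
    (λ b → t ∷ [] , [] ∷ [] , from (+-identityʳ (indicator t t)) (from (indicator-≈ ≈-refl) b))

  pointMass-≈ : ∀ {t x} → x ≈ t → prob (pointMass t) x ≃ 1#
  pointMass-≈ = indicator-≈

  pointMass-positive : ∀ {t x} → Positive (prob (pointMass t) x) → x ≈ t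
  pointMass-positive pos = toWitness (𝟏-holds pos)

module _ {S : Set} {v : S} {C : Pred S ℓ} where

  -- The bound by 1 comes from the total sum, and `C v` from the fact that a non-negative lower
  -- bound forces `v` itself into the list. The disjunction stands in for `𝟏[ C v ]`, which is
  -- available only for a small type `C v`.
  mass-dirac⁻ : ∀ {q} → below (mass (dirac v) C) q → q < 0ℚ ⊎ (q < 1ℚ × C v)
  mass-dirac⁻ {q} b = let xs , u , c , b′ = total⁻ (prob (dirac v)) b in
    [ inj₁ , (λ (q<1 , _) → [ inj₁ , (λ v∈ → inj₂ (q<1 , v∈)) ]′ (support xs c b′)) ]′
      (to (prob-sum (dirac v)) (xs , u , b′))
    where
    support : ∀ xs → All C xs → ∀ {q} → below (Σ[_] (prob (dirac v)) xs) q → q < 0ℚ ⊎ C v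
    support []       []       (inj₁ q<0) = inj₁ q<0
    support (x ∷ xs) (cx ∷ c) (r , s , inj₂ (_ , refl) , s< , q≤) = inj₂ cx
    support (x ∷ xs) (cx ∷ c) (r , s , inj₁ r<0 , s< , q≤) with support xs c s<
    ... | inj₁ s<0 = inj₁ (ℚ.≤-<-trans q≤ (ℚ.+-mono-< r<0 s<0))
    ... | inj₂ v∈  = inj₂ v∈

  mass-dirac⁺ : ∀ {q} → q < 0ℚ ⊎ (q < 1ℚ × C v) → below (mass (dirac v) C) q
  mass-dirac⁺ (inj₁ q<0)        = mass (dirac v) C .negative q<0
  mass-dirac⁺ (inj₂ (q<1 , v∈)) = total⁺ (prob (dirac v)) ([] ∷ []) (v∈ ∷ [])
    (from (+-identityʳ (prob (dirac v) v)) (from (𝟏-true refl) (inj₂ (q<1 , tt))))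

mass-dirac-mono : {S T : Set} {v : S} {w : T} {C : Pred S ℓ₁} {D : Pred T ℓ₂} →
                  (C v → D w) → mass (dirac v) C ≼ mass (dirac w) D
mass-dirac-mono Cv⇒Dw = mk≼ λ b →
  mass-dirac⁺ ([ inj₁ , (λ (q<1 , v∈) → inj₂ (q<1 , Cv⇒Dw v∈)) ]′ (mass-dirac⁻ b))

mass-dirac-cong : {S T : Set} {v : S} {w : T} {C : Pred S ℓ₁} {D : Pred T ℓ₂} →
                  (C v → D w) → (D w → C v) → mass (dirac v) C ≃ mass (dirac w) D
mass-dirac-cong f g = ≼-antisym (mass-dirac-mono f) (mass-dirac-mono g)

-- Decidable equality of states, and branching steps along finite walks

countable⇒≟ : {S : Set} → Countable (≡.setoid S) → DecidableEquality S
countable⇒≟ (f , injective) x y = map′ injective (cong f) (f x ℕ.≟ f y)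

module _ (em : ExcludedMiddle 1ℓ) {L : Set} {τ : L} (𝒞 : PA L τ) where
  open PA 𝒞

  private
    _≟_ : DecidableEquality State
    _≟_ = countable⇒≟ State-countable

    Steps : Setoid 1ℓ 1ℓ
    Steps = Pointwise.setoid
      (×-setoid (≡.setoid L) (×-setoid (distrSetoid (≡.setoid State)) (≡.setoid State)))

    open Setoid Steps using () renaming (_≈_ to _≈ˢ_)
    open Setoid (choiceSetoid 𝒞) using () renaming (Carrier to Choice; _≈_ to _≈ᶜ_)

  -- The scheduler must not move on when a loop brings it back to an earlier
  -- state of the walk, so it counts the steps made so far.
  module Follow (x : ℕ → State) (n : ℕ)
                (hop : ∀ {k} → k ℕ.< n → Δ (x k , τ , dirac (x (suc k))))
                {a : L} {μ : Distribution State} (d : Δ (x n , a , μ)) where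

    next : ℕ → Maybe (∃ Δ)
    next k with ℕ.<-cmp k n
    ... | tri< k<n _ _ = just (_ , hop k<n)
    ... | tri≈ _ _ _   = just (_ , d)
    ... | tri> _ _ _   = nothing

    -- A scheduler is also defined on paths that have left the walk. Stopping there keeps every
    -- scheduled transition enabled at the current state.
    onlyFrom : State → Maybe (∃ Δ) → Choice
    onlyFrom t nothing        = nothing
    onlyFrom t (just (m , e)) with proj₁ m ≟ t
    ... | yes _ = just (m , e)
    ... | no  _ = nothing

    move : ℕ → State → Choice
    move k t = onlyFrom t (next k)

    onlyFrom-source : ∀ t m {z} → just z ≈ᶜ onlyFrom t m → proj₁ (proj₁ z) ≡ t
    onlyFrom-source t (just (m , e)) z≈ with proj₁ m ≟ t | z≈
    ... | yes u≡t | just (v≡u , _) = trans v≡u u≡t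

    onlyFrom-enabled : ∀ {t} m e → proj₁ m ≡ t → onlyFrom t (just (m , e)) ≡ just (m , e)
    onlyFrom-enabled {t} m e u≡t with proj₁ m ≟ t
    ... | yes _   = refl
    ... | no  u≢t = contradiction u≡t u≢t

    -- The membership proof is existential because `next` builds it from the proof of `k < n` that
    -- the comparison returns.
    move-< : ∀ {k t} → k ℕ.< n → t ≡ x k →
             ∃ λ e → move k t ≡ just ((x k , τ , dirac (x (suc k))) , e)
    move-< {k} k<n t≡ with ℕ.<-cmp k n
    ... | tri< k<n _ _   = hop k<n , onlyFrom-enabled _ (hop k<n) (sym t≡)
    ... | tri≈ k≮n _ _   = contradiction k<n k≮n
    ... | tri> k≮n _ _   = contradiction k<n k≮n

    move-last : ∀ {t} → t ≡ x n → move n t ≡ just ((x n , a , μ) , d)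
    move-last t≡ with ℕ.<-cmp n n
    ... | tri< _ n≢n _ = contradiction refl n≢n
    ... | tri≈ _ _ _   = onlyFrom-enabled _ d (sym t≡)
    ... | tri> _ n≢n _ = contradiction refl n≢n

    move-stop : ∀ {t} → move (suc n) t ≡ nothing
    move-stop with ℕ.<-cmp (suc n) n
    ... | tri< _ _ n≮n+1 = contradiction (ℕ.n<1+n n) n≮n+1
    ... | tri≈ _ _ n≮n+1 = contradiction (ℕ.n<1+n n) n≮n+1
    ... | tri> _ _ _     = refl

    -- Equality of choices includes equality of distributions, which excluded middle decides.
    point : Choice → Distr (choiceSetoid 𝒞)
    point = pointMass (choiceSetoid 𝒞) (λ _ _ → em)

    point-≡ : ∀ {y z} → y ≡ z → prob (point y) z ≃ 1#
    point-≡ {y} refl = pointMass-≈ (choiceSetoid 𝒞) (λ _ _ → em) (Setoid.refl (choiceSetoid 𝒞) {y})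

    point-positive : ∀ {y y′ z} → y ≡ y′ → Positive (prob (point y) z) → z ≈ᶜ y′
    point-positive refl = pointMass-positive (choiceSetoid 𝒞) (λ _ _ → em)

    ∣_∣ : ∀ {s t} → Path 𝒞 s t → ℕ
    ∣ π ∣ = length (steps 𝒞 π)

    scheduler : Scheduler 𝒞
    scheduler = record
      { choose      = λ {_} {t} π → point (move ∣ π ∣ t)
      -- The choice depends only on the length and the last state of the path, and equal paths agree
      -- in both.
      ; choose-cong = λ {_} {t} {π} π≈π′ z →
          subst (λ k → prob (point (move ∣ π ∣ t)) z ≃ prob (point (move k t)) z)
                (Pointwise.Pointwise-length π≈π′) ≃-refl
      ; enabled     = λ {_} {t} π e pos → onlyFrom-source t (next ∣ π ∣) (point-positive refl pos)
      }

    open Scheduler scheduler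

    trace : ℕ → List (L × Distribution State × State)
    trace zero    = []
    trace (suc k) = (τ , dirac (x (suc k)) , x (suc k)) ∷ trace k

    -- The invariant of scheduled paths: the Dirac hops keep the probability at 1, and only the
    -- final transition contributes a factor `prob μ t`.
    data Stage {t} (π : Path 𝒞 (x 0) t) : Set₁ where
      travelling : ∀ k → ∣ π ∣ ≡ k → k ℕ.≤ n → t ≡ x k →
                   steps 𝒞 π ≈ˢ trace k → pathProb π ≃ 1# → Stage π
      arrived    : ∣ π ∣ ≡ suc n →
                   steps 𝒞 π ≈ˢ ((a , μ , t) ∷ trace n) → pathProb π ≃ prob μ t → Stage π

    stage : ∀ {t} (π : Path 𝒞 (x 0) t) → Scheduled π → Stage π
    stage start _ = travelling 0 refl z≤n refl [] ≃-refl
    stage (_▷⟨_⟩[_,_] {u} {b} {ν} π e t t∈ν) (sch , chosen) with stage π sch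
    -- After `d` the scheduler stops, so no extension is scheduled.
    ... | arrived len _ _ with point-positive (trans (cong (λ k → move k u) len) move-stop) chosen
    ...   | ()
    stage (_▷⟨_⟩[_,_] {u} {b} {ν} π e t t∈ν) (sch , chosen)
        | travelling k len k≤n u≡ st pr with ℕ.m≤n⇒m<n∨m≡n k≤n
    ... | inj₁ k<n with move-< k<n u≡
    ...   | e′ , eq with point-positive (trans (cong (λ k → move k u) len) eq) chosen
    ...     | just (_ , refl , ν≈) = travelling (suc k) (cong suc len) k<n t≡ ((refl , ν≈ , t≡) ∷ st)
              (≃-trans (*-cong (≃-trans (*-cong pr chosen≃1) (*-identityˡ 1#)) ν≃1) (*-identityˡ 1#))
      where
      t≡ : t ≡ x (suc k)
      -- `ν` agrees with `dirac (x (suc k))`, and a path only enters states of positive probability.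
      t≡ = 𝟏-holds (to (ν≈ t) t∈ν)
      chosen≃1 : prob (choose π) (just (_ , e)) ≃ 1#
      chosen≃1 = 𝟏-true (𝟏-holds chosen)
      ν≃1 : prob ν t ≃ 1#
      ν≃1 = ≃-trans (ν≈ t) (𝟏-true t≡)
    stage (_▷⟨_⟩[_,_] {u} {b} {ν} π e t t∈ν) (sch , chosen)
        | travelling k len k≤n u≡ st pr | inj₂ refl
      with point-positive (trans (cong (λ k → move k u) len) (move-last u≡)) chosen
    ... | just (_ , refl , ν≈) = arrived (cong suc len) ((refl , ν≈ , refl) ∷ st)
            (≃-trans (*-cong (≃-trans (*-cong pr chosen≃1) (*-identityˡ 1#)) (ν≈ t)) (*-identityˡ (prob μ t)))
      where
      chosen≃1 : prob (choose π) (just (_ , e)) ≃ 1#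
      chosen≃1 = 𝟏-true (𝟏-holds chosen)

    record Arrived {t} (π : Path 𝒞 (x 0) t) : Set₁ where
      field
        isSteps : steps 𝒞 π ≈ˢ ((a , μ , t) ∷ trace n)
        isProb  : pathProb π * stop π ≃ prob μ t
    open Arrived

    -- While travelling, the point mass sits on a transition, so the probability of stopping is not
    -- positive.
    maximal⇒arrived : ∀ {t} (π : Path 𝒞 (x 0) t) → Maximal π → Arrived π
    maximal⇒arrived {t} π (sch , stops) with stage π sch
    ... | arrived len st pr = record
      { isSteps = st
      ; isProb  = ≃-trans (*-cong pr (𝟏-true (𝟏-holds stops))) (*-identityʳ (prob μ t))
      }
    ... | travelling k len k≤n t≡ st pr with ℕ.m≤n⇒m<n∨m≡n k≤n
    ...   | inj₁ k<n with point-positive (trans (cong (λ k → move k t) len) (proj₂ (move-< k<n t≡))) stops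
    ...     | ()
    maximal⇒arrived {t} π (sch , stops)
        | travelling k len k≤n t≡ st pr | inj₂ refl
      with point-positive (trans (cong (λ k → move k t) len) (move-last t≡)) stops
    ... | ()

    -- The hops are taken from `move-<`, so that they coincide with the choices of the scheduler.
    route : ∀ k → k ℕ.≤ n → Path 𝒞 (x 0) (x k)
    route zero    _   = start
    route (suc k) k<n = route k (ℕ.<⇒≤ k<n) ▷⟨ proj₁ (move-< k<n refl) ⟩[ x (suc k) , 𝟏-positive refl ]

    ∣route∣ : ∀ k k≤n → ∣ route k k≤n ∣ ≡ k
    ∣route∣ zero    _   = refl
    ∣route∣ (suc k) k<n = cong suc (∣route∣ k (ℕ.<⇒≤ k<n))

    positive-at : ∀ {y z} → y ≡ z → Positive (prob (point y) z)
    positive-at {z = z} y≡z = from (point-≡ y≡z) (𝟏-positive tt)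

    route-scheduled : ∀ k k≤n → Scheduled (route k k≤n)
    route-scheduled zero    _   = tt
    route-scheduled (suc k) k<n =
      route-scheduled k (ℕ.<⇒≤ k<n) ,
      positive-at (trans (cong (λ j → move j (x k)) (∣route∣ k (ℕ.<⇒≤ k<n))) (proj₂ (move-< k<n refl)))

    full : ∀ {t} → Positive (prob μ t) → ∃ λ (π : Path 𝒞 (x 0) t) → Maximal π
    full {t} t∈μ = route n ℕ.≤-refl ▷⟨ d ⟩[ t , t∈μ ]
      , (route-scheduled n ℕ.≤-refl ,
         positive-at (trans (cong (λ j → move j (x n)) (∣route∣ n ℕ.≤-refl)) (move-last refl)))
      , positive-at (trans (cong (λ j → move (suc j) t) (∣route∣ n ℕ.≤-refl)) move-stop)

    -- All maximal paths to `t` have the same steps, hence are equal as paths, and one exists as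
    -- soon as `prob μ t` is positive.
    final≃ : ∀ t → final (x 0) t ≃ prob μ t
    final≃ t = ∑-subsingleton (restrict (pathSetoid 𝒞 (x 0) t) Maximal)
      (λ (π , m) (π′ , m′) → Setoid.trans Steps (isSteps (maximal⇒arrived π m))
                               (Setoid.sym Steps (isSteps (maximal⇒arrived π′ m′))))
      (λ (π , m) → isProb (maximal⇒arrived π m))
      full

    module _ {R : Rel State 1ℓ} (R-walk : ∀ k → k ℕ.≤ n → R (x 0) (x k)) where

      Silent : L × Distribution State × State → Set₁
      Silent (b , _ , t) = b ≡ τ × R (x 0) t

      trace-silent : ∀ k → k ℕ.≤ n → All Silent (trace k)
      trace-silent zero    _   = []
      trace-silent (suc k) k<n = (refl , R-walk (suc k) k<n) ∷ trace-silent k (ℕ.<⇒≤ k<n)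

      maximal-branching : ∀ {t} (π : Path 𝒞 (x 0) t) → Maximal π → BranchingPath 𝒞 R a π
      maximal-branching π m = go π (isSteps (maximal⇒arrived π m))
        where
        go : ∀ {t} (π : Path 𝒞 (x 0) t) → steps 𝒞 π ≈ˢ ((a , μ , t) ∷ trace n) → BranchingPath 𝒞 R a π
        go (π ▷⟨ _ ⟩[ _ , _ ]) ((b≡a , _) ∷ st) = b≡a ,
          Pointwise.All-resp-Pointwise (λ { (refl , _ , refl) p → p })
            (Setoid.sym Steps st) (trace-silent n ℕ.≤-refl)

      branching : BranchingStep 𝒞 R (x 0) a μ
      branching = inj₂ (scheduler , final≃ , maximal-branching)

  module _ {R : Rel State 1ℓ} (R-equiv : IsEquivalence R) where
    private module R = IsEquivalence R-equiv

    InertStep : Rel State 1ℓ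
    InertStep u v = Δ (u , τ , dirac v) × R u v

    -- Indexing the states by the number of steps made lets a scheduler read the next hop off the
    -- length of the path.
    record Walk (s r : State) : Set₁ where
      constructor walk
      field
        size    : ℕ
        visited : ℕ → State
        first   : visited 0 ≡ s
        last    : visited size ≡ r
        inert   : ∀ {k} → k ℕ.< size → InertStep (visited k) (visited (suc k))

    star⇒walk : ∀ {s r} → Star InertStep s r → Walk s r
    star⇒walk {s} ε = walk 0 (λ _ → s) refl refl λ ()
    star⇒walk {s} (step ◅ steps) with star⇒walk steps
    ... | walk n x refl last inert = walk (suc n) x′ refl last inert′
      where
      x′ : ℕ → State
      x′ zero    = s
      x′ (suc k) = x k
      inert′ : ∀ {k} → k ℕ.< suc n → InertStep (x′ k) (x′ (suc k))
      inert′ {zero}  _   = step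
      inert′ {suc k} k<n = inert (ℕ.s<s⁻¹ k<n)

    -- Inert steps stay in the class of `s`, by transitivity along the walk, so following them and
    -- then taking the given transition is a branching step.
    branchingStep : ∀ {s r a μ} → Star InertStep s r → Δ (r , a , μ) → BranchingStep 𝒞 R s a μ
    branchingStep steps d with star⇒walk steps
    ... | walk n x refl refl inert = Follow.branching x n (proj₁ ∘ inert) d R-walk
      where
      R-walk : ∀ k → k ℕ.≤ n → R (x 0) (x k)
      R-walk zero    _   = R.refl
      R-walk (suc k) k<n = R.trans (R-walk k (ℕ.<⇒≤ k<n)) (proj₂ (inert k<n))

-- Representatives and the relation on the disjoint union

module Reduction (em : ExcludedMiddle 1ℓ) {L : Set} {τ : L} (𝒜 : PA L τ)
                 (c : Pred (Transition (PA.State 𝒜) L) 1ℓ)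
                 (deterministicτ : IsDeterministicτSet 𝒜 c)
                 (isConfluent : IsConfluent 𝒜 c)
                 (φ : PA.State 𝒜 → PA.State 𝒜)
                 (isRepresentationMap : IsRepresentationMap 𝒜 c φ) where
  open PA 𝒜 renaming (State to S)
  open IsDeterministicτSet deterministicτ
  open IsConfluent isConfluent using (confluent)
  open IsRepresentationMap isRepresentationMap
  open Reduced 𝒜 c φ using (State/φ; value-injective)

  _↠_ _≈ᶜ_ : Rel S 1ℓ
  _↠_ = _↠c_ 𝒜 c
  _≈ᶜ_ = R[c] 𝒜 c

  𝒰 : PA L τ
  𝒰 = reduced 𝒜 c φ ⊎ᴾᴬ 𝒜

  open PA 𝒰 using () renaming (State to U; Δ to Δᵁ)

  _≟ᵁ_ : DecidableEquality U
  _≟ᵁ_ = countable⇒≟ (PA.State-countable 𝒰)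

  φ-↠ : ∀ {s t} → s ↠ t → φ s ≡ φ t
  φ-↠ ε        = refl
  φ-↠ (st ◅ p) = trans (constant st) (φ-↠ p)

  φ-idempotent : ∀ s → φ (φ s) ≡ φ s
  φ-idempotent s = sym (φ-↠ (reachable s))

  ≈ᶜ⇒φ≡ : ∀ {s t} → s ≈ᶜ t → φ s ≡ φ t
  ≈ᶜ⇒φ≡ (_ , s↠u , t↠u) = trans (φ-↠ s↠u) (sym (φ-↠ t↠u))

  φ≡⇒≈ᶜ : ∀ {s t} → φ s ≡ φ t → s ≈ᶜ t
  φ≡⇒≈ᶜ {s} {t} eq = φ s , reachable s , subst (t ↠_) (sym eq) (reachable t)

  repr : S → State/φ
  repr s = φ s , [ s , refl ]

  rep : U → S
  rep (inj₁ x) = value x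
  rep (inj₂ s) = φ s

  φ-rep : ∀ u → φ (rep u) ≡ rep u
  -- Membership in the image is irrelevant, so the equation is recovered from it by decidability of
  -- equality.
  φ-rep (inj₁ (y , [ y∈φS ])) = recompute (countable⇒≟ State-countable _ _) (fixed y∈φS)
    where
    fixed : ∃ (λ s → φ s ≡ y) → φ y ≡ y
    fixed (s , refl) = φ-idempotent s
  φ-rep (inj₂ s) = φ-idempotent s

  _~_ : Rel U 1ℓ
  u ~ v = Lift 1ℓ (rep u ≡ rep v)

  ~-isEquivalence : IsEquivalence _~_
  ~-isEquivalence = record
    { refl  = lift refl
    ; sym   = λ { (lift p) → lift (sym p) }
    ; trans = λ { (lift p) (lift q) → lift (trans p q) }
    }

  -- Transfers confluence, which speaks of `R[c]` on `S`, to `_~_`: distributions lying over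
  -- `R[c]`-equivalent ones agree on every class of `_~_`.
  _Over_ : Distribution U → Distribution S → Set₁
  μ Over ν = ∀ w → mass μ (w ~_) ≃ mass ν (rep w ≈ᶜ_)

  -- The preimage under `h` of the class of `w` is the `R[c]`-class of `rep w`, because `h`
  -- preserves representatives and `rep w` represents itself.
  pushforward-over : ∀ h → (∀ s → rep (h s) ≡ φ s) → ∀ ν → pushforward _≟ᵁ_ h ν Over ν
  pushforward-over h rep-h ν w = ≃-trans (total-fibreTotal _≟ᵁ_ h (prob ν)) (total-cong (prob ν)
    (λ { {s} (lift eq) → φ≡⇒≈ᶜ (trans (φ-rep w) (trans eq (rep-h s))) })
    (λ {s} w≈s → lift (trans (sym (φ-rep w)) (trans (≈ᶜ⇒φ≡ w≈s) (sym (rep-h s))))))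

  dirac-over : ∀ {v s} → φ s ≡ rep v → dirac v Over dirac s
  dirac-over {v} φs≡ w = mass-dirac-cong
    (λ { (lift eq) → φ≡⇒≈ᶜ (trans (φ-rep w) (trans eq (sym φs≡))) })
    (λ w≈s → lift (trans (sym (φ-rep w)) (trans (≈ᶜ⇒φ≡ w≈s) φs≡)))

  -- Transitions of the disjoint union and the transfer condition

  onOriginal onReduced : Distribution S → Distribution U
  onOriginal = pushforward _≟ᵁ_ inj₂
  onReduced  = pushforward _≟ᵁ_ (inj₁ ∘ repr)

  onOriginal-inj₂ : ∀ ν y → prob (onOriginal ν) (inj₂ y) ≃ prob ν y
  onOriginal-inj₂ ν y = ∑-subsingleton (restrict (≡.setoid S) (λ s → inj₂ s ≡ inj₂ y))
    (λ (_ , p) (_ , q) → inj₂-injective (trans p (sym q)))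
    (λ { (_ , refl) → ≃-refl })
    (λ _ → y , refl)

  onOriginal-inj₁ : ∀ ν x → prob (onOriginal ν) (inj₁ x) ≃ 0#
  onOriginal-inj₁ ν x = total-∅ (prob ν) λ ()

  onReduced-inj₁ : ∀ ν x → prob (onReduced ν) (inj₁ x) ≃ mass ν (λ s → φ s ≡ value x)
  onReduced-inj₁ ν x = total-cong (prob ν)
    (λ eq → cong value (inj₁-injective eq)) (λ eq → cong inj₁ (value-injective _ x eq))

  onReduced-inj₂ : ∀ ν y → prob (onReduced ν) (inj₂ y) ≃ 0#
  onReduced-inj₂ ν y = total-∅ (prob ν) λ ()

  -- A transition of the quotient carries the transition of the original automaton that induces it;
  -- either way the distribution is an image of `ν` under a map preserving representatives.
  project : ∀ u {a μ} → Δᵁ (u , a , μ) →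
            ∃₂ λ s ν → φ s ≡ rep u × Δ (s , a , ν) × μ Over ν
  project (inj₁ x) {μ = μ} (μ₁ , (t , ν , d , _ , φt≡ , μ₁≃) , μ-inj₁ , μ-inj₂) =
    t , ν , φt≡ , d , λ w →
      ≃-trans (mass-cong μ (onReduced ν) (w ~_) μ≈) (pushforward-over (inj₁ ∘ repr) (λ _ → refl) ν w)
    where
    μ≈ : μ ≈ᵈ onReduced ν
    μ≈ (inj₁ y) = ≃-trans (μ-inj₁ y) (≃-trans (μ₁≃ y) (≃-sym (onReduced-inj₁ ν y)))
    μ≈ (inj₂ y) = ≃-trans (μ-inj₂ y) (≃-sym (onReduced-inj₂ ν y))
  project (inj₂ s) {μ = μ} (ν , d , μ-inj₁ , μ-inj₂) =
    s , ν , refl , d , λ w →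
      ≃-trans (mass-cong μ (onOriginal ν) (w ~_) μ≈) (pushforward-over inj₂ (λ _ → refl) ν w)
    where
    μ≈ : μ ≈ᵈ onOriginal ν
    μ≈ (inj₁ y) = ≃-trans (μ-inj₁ y) (≃-sym (onOriginal-inj₁ ν y))
    μ≈ (inj₂ y) = ≃-trans (μ-inj₂ y) (≃-sym (onOriginal-inj₂ ν y))

  original-step : ∀ {s a ν} → Δ (s , a , ν) → Δᵁ (inj₂ s , a , onOriginal ν)
  original-step {ν = ν} d = ν , d , onOriginal-inj₁ ν , onOriginal-inj₂ ν

  inert-walk : ∀ {s t} → s ↠ t → Star (InertStep em 𝒰 ~-isEquivalence) (inj₂ s) (inj₂ t)
  inert-walk = Star.gmap inj₂ λ {s} {t} st →
    (dirac t , transition st ,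
     (λ _ → ¬positive⇒≃0 ((λ ()) ∘ 𝟏-holds)) ,
     (λ _ → 𝟏-cong inj₂-injective (cong inj₂))) ,
    lift (constant st)

  reduced-step : ∀ {s x a ν} → Δ (s , a , ν) → ¬ c (s , a , ν) → φ s ≡ value x →
                 Δᵁ (inj₁ x , a , onReduced ν)
  reduced-step {s} {ν = ν} d d∉c φs≡ =
    pushforward (countable⇒≟ (PA.State-countable (reduced 𝒜 c φ))) repr ν ,
    (s , ν , d , d∉c , φs≡ , λ y → total-cong (prob ν) (cong value) (value-injective _ y)) ,
    (λ y → total-cong (prob ν) inj₁-injective (cong inj₁)) ,
    onReduced-inj₂ ν

  -- Confluence yields a transition of the representative, which `v` itself need not have, so `v`
  -- must be able to simulate it.
  respond : ∀ v {a ν} → Δ (rep v , a , ν) →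
            ∃ λ μ → BranchingStep 𝒰 _~_ v a μ × μ Over ν
  respond (inj₂ t) {ν = ν} d =
    onOriginal ν , branchingStep em 𝒰 ~-isEquivalence {μ = onOriginal ν}
      (inert-walk (reachable t)) (original-step d) ,
    pushforward-over inj₂ (λ _ → refl) ν
  respond v@(inj₁ x) {a} {ν} d with em {c (value x , a , ν)}
  ... | no d∉c = onReduced ν ,
    branchingStep em 𝒰 ~-isEquivalence {μ = onReduced ν} ε
      (reduced-step {x = x} {ν = ν} d d∉c (φ-rep v)) ,
    pushforward-over (inj₁ ∘ repr) (λ _ → refl) ν
  ... | yes d∈c with refl ← internal d∈c | t , ν≈ ← deterministic d∈c =
    dirac v , inj₁ (refl , λ _ → ≃-refl) , λ w →
      -- `respects` turns the transition in `c` into a step to `t`, and `constant` then shows that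
      -- its target has the same representative as `v`.
      ≃-trans (dirac-over {v} {t} (trans (sym (constant (respects (refl , refl , ν≈) d∈c))) (φ-rep v)) w)
              (≃-sym (mass-cong ν (dirac t) (rep w ≈ᶜ_) ν≈))

  ~-bisimulation : IsBranchingBisimulation 𝒰 _~_
  ~-bisimulation = record { isEquivalence = ~-isEquivalence ; transfer = transfer }
    where
    transfer : ∀ {u v} → u ~ v → ∀ {a μ} → Δᵁ (u , a , μ) →
               ∃ λ μ′ → BranchingStep 𝒰 _~_ v a μ′ × μ ≡[ _~_ ] μ′
    transfer {u} {v} (lift u≡v) {a} {μ} d with s , ν , φs≡ , e , over ← project u d
      with φs≡v ← trans φs≡ u≡v
      -- Moves the transition from `s` to `φ s`, which is `rep v` by `φs≡v`.
      with confluent (reachable s) e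
    ... | inj₁ (ν′ , e′ , ν≡ν′) =
      let μ′ , step , over′ = respond v (subst (λ r → Δ (r , a , ν′)) φs≡v e′)
      in  μ′ , step , λ w → ≃-trans (over w) (≃-trans (ν≡ν′ (rep w)) (≃-sym (over′ w)))
    ... | inj₂ (a≡τ , ν≡dirac) =
      dirac v , inj₁ (a≡τ , λ _ → ≃-refl) , λ w → ≃-trans (over w) (≃-trans (ν≡dirac (rep w))
        (≃-sym (dirac-over (trans (φ-idempotent s) φs≡v) w)))

theorem26 : ExcludedMiddle 1ℓ →
    {L : Set} {τ : L} (𝒜 : PA L τ)
    (c : Pred (Transition (PA.State 𝒜) L) 1ℓ) →
    IsDeterministicτSet 𝒜 c →
    IsConfluent 𝒜 c →
    (φ : PA.State 𝒜 → PA.State 𝒜) →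
    IsRepresentationMap 𝒜 c φ →
    Bisimilar (reduced 𝒜 c φ) 𝒜
-- Both initial states have representative `φ init`, whence `lift refl`.
theorem26 em 𝒜 c deterministicτ isConfluent φ isRepresentationMap = _~_ , ~-bisimulation , lift refl
  where open Reduction em 𝒜 c deterministicτ isConfluent φ isRepresentationMap
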